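{- Let $Q=T[H_1,\dots,H_t]$ be a $k$-strong-connected semicomplete composition with $T\notin\mathcal{T}_1$. If $V(H_i)$ induces a connected component of $\overline{U(Q)}$ for some $i\in\{1,\dots,t\}$, then deleting from $Q$ all arcs of $H_i$ (all arcs with both ends in $V(H_i)$) results in a $k$-strong-connected semicomplete composition.
   Context: Digraphs are finite, without loops or parallel arcs (2-cycles are allowed). A digraph is semicomplete if there is at least one arc between every pair of distinct vertices. Let $T$ be a digraph with vertices $u_1,\dots,u_t$ ($t\ge 2$) and let $H_1,\dots,H_t$ be pairwise disjoint nonempty digraphs, where $H_i$ has $n_i$ vertices. The composition $Q=T[H_1,\dots,H_t]$ is the digraph with vertex set $\bigcup_i V(H_i)$ and arc set $\bigcup_{i=1}^t A(H_i)\cup\{xy : x\in V(H_i),\ y\in V(H_p),\ u_iu_p\in A(T)\}$. It is a semicomplete composition if $T$ is semicomplete. A digraph is strong if for every ordered pair of vertices $(x,y)$ there is a directed path from $x$ to $y$ (a one-vertex digraph is strong). $\mathcal{T}_1$ is the set of all semicomplete digraphs $T$ for which there exists a vertex $u$ such that $uv,vu\in A(T)$ for every $v\in V(T)\setminus\{u\}$. $U(D)$ denotes the underlying undirected graph of $D$, and $\overline{G}$ the complement of a graph $G$. A set $S\subseteq V(D)$ is a separator of $D$ if $D-S$ is not strong. A digraph is $k$-strong-connected if every separator has at least $k$ vertices. -}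

module Defs where

open import Data.Nat using (ℕ; _≤_)
open import Data.Fin using (Fin)
import Data.Fin.Properties as Fin
open import Data.List using (List; []; _∷_; length)
open import Data.List.Membership.Propositional using (_∉_)
open import Data.List.Relation.Unary.Unique.Propositional using (Unique)
open import Data.Product using (Σ; ∃-syntax; _×_; _,_; proj₁)
open import Data.Refinement using (Refinement; value)
open import Data.Sum using (_⊎_; inj₁; inj₂; swap)
open import Function using (_∘_; _on_; _↔_; _⇔_; Inverse)
open import Level using (0ℓ)
open import Relation.Binary using (Rel; Decidable; Symmetric)
open import Relation.Binary.Construct.Closure.ReflexiveTransitive using (Star; ε; _◅_)
open import Relation.Binary.PropositionalEquality using (_≡_; _≢_; refl; sym)
open import Relation.Nullary using (¬_; yes; no; _×-dec_; ¬?)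
open import Relation.Unary using (Pred; _⊆_; Satisfiable)
import Relation.Unary as Unary

private
  variable
    V W : Set

vertices : {R : Rel V 0ℓ} {x y : V} → Star R x y → List V
vertices {x = x} ε       = x ∷ []
vertices {x = x} (_ ◅ p) = x ∷ vertices p

-- Paths, as opposed to walks, do not repeat vertices.
Path : Rel V 0ℓ → Rel V 0ℓ
Path R x y = Σ (Star R x y) (Unique ∘ vertices)

record Graph (V : Set) : Set₁ where
  field
    Adj    : Rel V 0ℓ
    symm   : Symmetric Adj
    noLoop : ∀ x → ¬ Adj x x

complement : Graph V → Graph V
complement G = record
  { Adj    = λ x y → x ≢ y × ¬ Adj x y
  ; symm   = λ (x≢y , ¬xy) → x≢y ∘ sym , ¬xy ∘ symm
  ; noLoop = λ x (x≢x , _) → x≢x refl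
  }
  where open Graph G

-- Refinement makes membership proofs irrelevant, so that the elements of
-- Refinement V P are exactly the vertices satisfying P.
inducedGraph : Graph V → (P : Pred V 0ℓ) → Graph (Refinement V P)
inducedGraph G P = record
  { Adj    = Adj on value
  ; symm   = symm
  ; noLoop = noLoop ∘ value
  }
  where open Graph G

Connected : Graph V → Set
Connected G = ∀ x y → Path (Graph.Adj G) x y

InducesComponent : Graph V → Pred V 0ℓ → Set₁
InducesComponent {V} G P =
  Satisfiable P ×
  Connected (inducedGraph G P) ×
  ((P′ : Pred V 0ℓ) → P ⊆ P′ → Connected (inducedGraph G P′) → P′ ⊆ P)

-- V is not required to be finite here: finiteness comes from the vertex
-- types used in SemicompleteComposition.
record Digraph (V : Set) : Set₁ where
  field
    Arc    : Rel V 0ℓ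
    arc?   : Decidable Arc
    noLoop : ∀ x → ¬ Arc x x

open Digraph

underlying : Digraph V → Graph V
underlying D = record
  { Adj    = λ x y → Arc D x y ⊎ Arc D y x
  ; symm   = swap
  ; noLoop = λ { x (inj₁ a) → noLoop D x a ; x (inj₂ a) → noLoop D x a }
  }

induced : Digraph V → (P : Pred V 0ℓ) → Digraph (Refinement V P)
induced D P = record
  { Arc    = Arc D on value
  ; arc?   = λ x y → arc? D (value x) (value y)
  ; noLoop = noLoop D ∘ value
  }

infixl 6 _−_
_−_ : (D : Digraph V) (S : List V) → Digraph (Refinement V (_∉ S))
D − S = induced D (_∉ S)

deleteArcsWithin : Digraph V → {P : Pred V 0ℓ} → Unary.Decidable P → Digraph V
deleteArcsWithin D {P} P? = record
  { Arc    = λ x y → Arc D x y × ¬ (P x × P y)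
  ; arc?   = λ x y → arc? D x y ×-dec ¬? (P? x ×-dec P? y)
  ; noLoop = λ x → noLoop D x ∘ proj₁
  }

Strong : Digraph V → Set
Strong D = ∀ x y → Path (Arc D) x y

Separator : Digraph V → List V → Set
Separator D S = ¬ Strong (D − S)

-- Finite vertex sets are duplicate-free lists, so that length is cardinality.
StrongConnected : ℕ → Digraph V → Set
StrongConnected {V} k D = (S : List V) → Unique S → Separator D S → k ≤ length S

Semicomplete : Digraph V → Set
Semicomplete D = ∀ x y → x ≢ y → Arc D x y ⊎ Arc D y x

𝒯₁ : Digraph V → Set
𝒯₁ T = Semicomplete T × ∃[ u ] (∀ v → v ≢ u → Arc T u v × Arc T v u)

infix 4 _≅_
record _≅_ (D : Digraph V) (E : Digraph W) : Set where
  field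
    bijection : V ↔ W
    arc⇔arc   : ∀ x y → Arc D x y ⇔ Arc E (Inverse.to bijection x) (Inverse.to bijection y)

module _ {t : ℕ} (T : Digraph (Fin t)) {n : Fin t → ℕ} (H : ∀ i → Digraph (Fin (n i))) where

  -- Tagging by the index makes the vertex sets of the H i disjoint.
  data CompositionArc : Rel (Σ (Fin t) (Fin ∘ n)) 0ℓ where
    inner : ∀ {i x y} → Arc (H i) x y → CompositionArc (i , x) (i , y)
    outer : ∀ {i p x y} → Arc T i p → CompositionArc (i , x) (p , y)

  private
    compositionArc? : Decidable CompositionArc
    compositionArc? (i , x) (p , y) with arc? T i p
    ... | yes a = yes (outer a)
    ... | no ¬a with i Fin.≟ p
    ...   | no i≢p = no λ { (inner _) → i≢p refl ; (outer a) → ¬a a }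
    ...   | yes refl with arc? (H i) x y
    ...     | yes b = yes (inner b)
    ...     | no ¬b = no λ { (inner b) → ¬b b ; (outer a) → ¬a a }

  composition : Digraph (Σ (Fin t) (Fin ∘ n))
  composition = record
    { Arc    = CompositionArc
    ; arc?   = compositionArc?
    ; noLoop = λ { (i , x) (inner a) → noLoop (H i) x a ; (i , x) (outer a) → noLoop T i a }
    }

record SemicompleteComposition : Set₁ where
  field
    t            : ℕ
    2≤t          : 2 ≤ t
    T            : Digraph (Fin t)
    semicomplete : Semicomplete T
    n            : Fin t → ℕ
    nonempty     : ∀ i → 1 ≤ n i
    H            : ∀ i → Digraph (Fin (n i))

  Vertex : Set
  Vertex = Σ (Fin t) (Fin ∘ n)

  digraph : Digraph Vertex
  digraph = composition T H

  InPart : Fin t → Pred Vertex 0ℓ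
  InPart i v = proj₁ v ≡ i

  inPart? : ∀ i → Unary.Decidable (InPart i)
  inPart? i v = proj₁ v Fin.≟ i

-- A digraph is determined only up to the naming of its vertices, hence ≅.
IsSemicompleteComposition : Digraph V → Set₁
IsSemicompleteComposition D = ∃[ Q ] (D ≅ SemicompleteComposition.digraph Q)

{-# OPTIONS --safe #-}

-- Let S separate the reduced digraph.  If some vertex outside H_i survives in
-- Q − S, then a strong Q − S stays strong when the arcs of H_i are deleted:
-- a walk through H_i may leave directly from the vertex where it entered,
-- because the vertices of H_i have the same neighbours outside H_i; so S
-- already separates Q.  Otherwise S contains every vertex outside H_i.  As
-- T ∉ 𝒯₁, some u_j fails to dominate or to be dominated by u_i, and then the
-- in- or out-neighbours of u_i within S alone separate H_i from H_j in Q.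
module Submission where

open import Defs
open import Data.Nat using (ℕ; _≤?_)
open import Data.Nat.Properties using (≤-trans)
open import Data.Fin using (Fin; fromℕ<)
import Data.Fin.Properties as Fin
open import Data.Empty using (⊥-elim; ⊥-elim-irr)
open import Data.Irrelevant using ([_])
open import Data.List using (List; filter; length)
open import Data.List.Membership.Propositional using (_∈_; _∉_)
open import Data.List.Membership.Propositional.Properties using (∈-filter⁺; ∈-filter⁻)
import Data.List.Membership.DecPropositional as DecMembership
open import Data.List.Properties using (length-filter)
open import Data.List.Relation.Unary.All using ([])
open import Data.List.Relation.Unary.All.Properties using (¬Any⇒All¬)
open import Data.List.Relation.Unary.Any using (here; there)
open import Data.List.Relation.Unary.AllPairs using ([]; _∷_)
open import Data.List.Relation.Unary.Unique.Propositional using (Unique)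
open import Data.List.Relation.Unary.Unique.Propositional.Properties using (filter⁺)
open import Data.Product using (∃-syntax; _×_; _,_; proj₁; proj₂)
open import Data.Product.Properties using (≡-dec)
open import Data.Refinement using (value; _,_)
import Data.Refinement.Properties as Refinement
open import Function using (_∘_; id; mk⇔)
open import Function.Construct.Identity using (↔-id)
open import Level using (0ℓ)
open import Relation.Binary using (Rel; DecidableEquality)
open import Relation.Binary.Construct.Closure.ReflexiveTransitive using (Star; ε; _◅_; _◅◅_)
open import Relation.Binary.PropositionalEquality using (_≢_; refl)
open import Relation.Nullary using (¬_; yes; no; _×-dec_; ¬?)
open import Relation.Nullary.Decidable using (decidable-stable)
open import Relation.Unary using (Pred)
import Relation.Unary as Unary

open Digraph

private
  variable
    V : Set

module _ {R : Rel V 0ℓ} where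

  pathFrom : ∀ {v x y} (p : Star R x y) → Unique (vertices p) → v ∈ vertices p → Path R v y
  pathFrom ε       u       (here refl) = ε , u
  pathFrom (a ◅ p) u       (here refl) = a ◅ p , u
  pathFrom (_ ◅ p) (_ ∷ u) (there v∈p) = pathFrom p u v∈p

  -- Prepending a vertex already on the path closes a cycle, which is cut off by keeping only the
  -- suffix from that vertex.
  star⇒path : DecidableEquality V → ∀ {x y} → Star R x y → Path R x y
  star⇒path _≟_ ε = ε , [] ∷ []
  star⇒path _≟_ {x} (a ◅ p) with star⇒path _≟_ p
  ... | q , u with DecMembership._∈?_ _≟_ x (vertices q)
  ...   | yes x∈q = pathFrom q u x∈q
  ...   | no  x∉q = a ◅ q , ¬Any⇒All¬ (vertices q) x∉q ∷ u

  star-closed : (P : Pred V 0ℓ) → (∀ {x y} → R x y → P x → P y) →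
                ∀ {x y} → Star R x y → P x → P y
  star-closed P closed ε       = id
  star-closed P closed (a ◅ p) = star-closed P closed p ∘ closed a

-- A module in the sense of modular decomposition.
Homogeneous : Digraph V → Pred V 0ℓ → Set
Homogeneous D P = ∀ {x y z} → P x → P y → ¬ P z →
  (Arc D x z → Arc D y z) × (Arc D z x → Arc D z y)

module _ (D : Digraph V) {P : Pred V 0ℓ} (P? : Unary.Decidable P)
         (homogeneous : Homogeneous D P) where

  private
    D′ : Digraph V
    D′ = deleteArcsWithin D P?

  -- Induction on the walk, with its tail rerouted first: when the first arc lies within `P`, the
  -- rerouted tail starts in `P` and its own first arc must leave `P`, so by homogeneity that arc
  -- can start at `x` instead. The tail cannot be empty, since the walk ends outside `P`.
  bypass : ∀ {x y} → Star (Arc D) x y → ¬ P y → Star (Arc D′) x y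
  bypass ε ¬Py = ε
  bypass {x} (_◅_ {j = x′} a p) ¬Py with P? x ×-dec P? x′ | bypass p ¬Py
  ... | no ¬both       | q = (a , ¬both) ◅ q
  ... | yes (Px , Px′) | ε = ⊥-elim (¬Py Px′)
  ... | yes (Px , Px′) | (b , ¬both) ◅ q = (proj₁ (homogeneous Px′ Px ¬Pz) b , ¬Pz ∘ proj₂) ◅ q
    where ¬Pz = λ Pz → ¬both (Px′ , Pz)

  -- The first arc of the walk that enters `P` may be redirected to `y` by homogeneity.
  entrance : ∀ {x y} → Star (Arc D) x y → ¬ P x → P y → ∃[ z ] ¬ P z × Arc D z y
  entrance ε ¬Px Py = ⊥-elim (¬Px Py)
  entrance {x} (_◅_ {j = x′} a p) ¬Px Py with P? x′
  ... | yes Px′ = x , ¬Px , proj₂ (homogeneous Px′ Py ¬Px) a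
  ... | no ¬Px′ = entrance p ¬Px′ Py

  deleteArcsWithin-strong : DecidableEquality V → ∀ {w} → ¬ P w → Strong D → Strong D′
  deleteArcsWithin-strong _≟_ {w} ¬Pw strong x y = star⇒path _≟_ walk
    where
    walk : Star (Arc D′) x y
    walk with P? y
    ... | no ¬Py = bypass (proj₁ (strong x y)) ¬Py
    ... | yes Py with entrance (proj₁ (strong w y)) ¬Pw Py
    -- `bypass` needs a target outside `P`, so the walk goes to an in-neighbour `z` of `y` outside
    -- `P` and takes one last arc.
    ...   | z , ¬Pz , a = bypass (proj₁ (strong x z)) ¬Pz ◅◅ (a , ¬Pz ∘ proj₁) ◅ ε

-- Vertices of `D − S` carry irrelevant proofs of `_∉ S`, which can only be used to reach a
-- contradiction; hence the invariant carried along the walk is `¬ ¬ P`.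
closed⇒separator : (D : Digraph V) (S : List V) (P : Pred V 0ℓ) →
                   (∀ {x y} → x ∉ S → y ∉ S → Arc D x y → P x → ¬ ¬ P y) →
                   ∀ {x y} → x ∉ S → y ∉ S → P x → ¬ P y → Separator D S
closed⇒separator D S P closed {x} {y} x∉S y∉S Px ¬Py strong =
  star-closed (λ v → ¬ ¬ P (value v))
    (λ { {_ , [ u∉S ]} {_ , [ v∉S ]} a ¬¬Pu ¬Pv →
         ¬¬Pu λ Pu → ⊥-elim-irr (closed u∉S v∉S a Pu ¬Pv) })
    (proj₁ (strong (x , [ x∉S ]) (y , [ y∉S ]))) (λ ¬Px → ¬Px Px) ¬Py

module _ (Q : SemicompleteComposition) (i : Fin (SemicompleteComposition.t Q)) where
  open SemicompleteComposition Q

  _≟ⱽ_ : DecidableEquality Vertex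
  _≟ⱽ_ = ≡-dec Fin._≟_ Fin._≟_

  open DecMembership _≟ⱽ_ using (_∈?_)

  inPart-homogeneous : Homogeneous digraph (InPart i)
  inPart-homogeneous refl refl z≢i =
    (λ { (inner _) → ⊥-elim (z≢i refl) ; (outer a) → outer a }) ,
    (λ { (inner _) → ⊥-elim (z≢i refl) ; (outer a) → outer a })

  deletePart-strong : (S : List Vertex) → ∀ {w} → ¬ InPart i w → w ∉ S →
                      Strong (digraph − S) → Strong (deleteArcsWithin digraph (inPart? i) − S)
  deletePart-strong S {w} w≢i w∉S =
    -- Removing `S` and deleting the arcs of the part commute definitionally.
    deleteArcsWithin-strong (digraph − S) (inPart? i ∘ value) inPart-homogeneous
      (Refinement._≟_ _≟ⱽ_)
      {w , [ w∉S ]} w≢i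

  representative : ∀ j → Vertex
  representative j = j , fromℕ< (nonempty j)

  module _ {S : List Vertex} (outside⊆S : ∀ w → ¬ InPart i w → w ∈ S) where

    inNeighbours outNeighbours : List Vertex
    inNeighbours  = filter (λ v → arc? T (proj₁ v) i) S
    outNeighbours = filter (λ v → arc? T i (proj₁ v)) S

    -- Every outside vertex dominating `H i` lies in `S`, hence in `inNeighbours`, so no remaining
    -- arc enters `H i`. The part `H j` survives by `¬ Arc T j i`, and `H i` because `T` has no
    -- loops.
    inNeighbours-separator : ∀ {j} → j ≢ i → ¬ Arc T j i → Separator digraph inNeighbours
    inNeighbours-separator {j} j≢i ¬ji =
      closed⇒separator digraph inNeighbours (¬_ ∘ InPart i) closed
        {representative j} {representative i}
        (¬ji ∘ arc) (noLoop T i ∘ arc) j≢i (λ i≢i → i≢i refl)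
      where
      arc : ∀ {v} → v ∈ inNeighbours → Arc T (proj₁ v) i
      arc = proj₂ ∘ ∈-filter⁻ _ {xs = S}
      closed : ∀ {x y} → x ∉ inNeighbours → y ∉ inNeighbours → Arc digraph x y →
               ¬ InPart i x → ¬ ¬ ¬ InPart i y
      closed _ _ (inner _) x≢i ¬y≢i = ¬y≢i x≢i
      closed x∉ _ (outer a) x≢i ¬y≢i =
        ¬y≢i λ { refl → x∉ (∈-filter⁺ _ (outside⊆S _ x≢i) a) }

    outNeighbours-separator : ∀ {j} → j ≢ i → ¬ Arc T i j → Separator digraph outNeighbours
    outNeighbours-separator {j} j≢i ¬ij =
      closed⇒separator digraph outNeighbours (InPart i) closed
        {representative i} {representative j}
        (noLoop T i ∘ arc) (¬ij ∘ arc) refl j≢i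
      where
      arc : ∀ {v} → v ∈ outNeighbours → Arc T i (proj₁ v)
      arc = proj₂ ∘ ∈-filter⁻ _ {xs = S}
      closed : ∀ {x y} → x ∉ outNeighbours → y ∉ outNeighbours → Arc digraph x y →
               InPart i x → ¬ ¬ InPart i y
      closed _ _ (inner _) refl y≢i = y≢i refl
      closed _ y∉ (outer a) refl y≢i = y∉ (∈-filter⁺ _ (outside⊆S _ y≢i) a)

  deletePart-strongConnected : ∀ {k} → StrongConnected k digraph → ¬ 𝒯₁ T →
                               StrongConnected k (deleteArcsWithin digraph (inPart? i))
  deletePart-strongConnected {k} connected T∉𝒯₁ S unique separates =
    decidable-stable (k ≤? length S) λ k≰∣S∣ →
      let outside⊆S : ∀ w → ¬ InPart i w → w ∈ S
          outside⊆S w w≢i = decidable-stable (w ∈? S) λ w∉S →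
            k≰∣S∣ (connected S unique (separates ∘ deletePart-strong S w≢i w∉S))

          -- A filtered sublist is duplicate-free and no longer than `S`, so as a separator it would
          -- force the bound denied by `k≰∣S∣`.
          ¬filter-separator : {P : Pred Vertex 0ℓ} (P? : Unary.Decidable P) →
                              ¬ Separator digraph (filter P? S)
          ¬filter-separator P? sep =
            k≰∣S∣ (≤-trans (connected (filter P? S) (filter⁺ P? unique) sep) (length-filter P? S))
      in T∉𝒯₁ (semicomplete , i , λ j j≢i →
           decidable-stable (arc? T i j) (¬filter-separator _ ∘ outNeighbours-separator outside⊆S j≢i) ,
           decidable-stable (arc? T j i) (¬filter-separator _ ∘ inNeighbours-separator outside⊆S j≢i))

  deletePart-isSemicompleteComposition :
    IsSemicompleteComposition (deleteArcsWithin digraph (inPart? i))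
  deletePart-isSemicompleteComposition = Q′ , record
    { bijection = ↔-id Vertex
    ; arc⇔arc   = λ x y → mk⇔
        (λ { (inner a , ¬both) → inner (a , λ j≡i → ¬both (j≡i , j≡i)) ; (outer a , _) → outer a })
        (λ { (inner (a , j≢i)) → inner a , j≢i ∘ proj₁
           ; (outer a) → outer a , λ { (refl , refl) → noLoop T i a } })
    }
    where
    Q′ : SemicompleteComposition
    Q′ = record
      { t = t ; 2≤t = 2≤t ; T = T ; semicomplete = semicomplete ; n = n ; nonempty = nonempty
      ; H = λ j → record
          -- The conjunct `j ≢ i` makes part `i` arcless and keeps the other parts intact, without a
          -- case split on `j`.
          { Arc    = λ x y → Arc (H j) x y × j ≢ i
          ; arc?   = λ x y → arc? (H j) x y ×-dec ¬? (j Fin.≟ i)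
          ; noLoop = λ x → noLoop (H j) x ∘ proj₁
          }
      }

theorem2p3 : (Q : SemicompleteComposition) (k : ℕ) →
    let open SemicompleteComposition Q in
    StrongConnected k digraph →
    ¬ 𝒯₁ T →
    (i : Fin t) →
    InducesComponent (complement (underlying digraph)) (InPart i) →
    StrongConnected k (deleteArcsWithin digraph (inPart? i)) ×
    IsSemicompleteComposition (deleteArcsWithin digraph (inPart? i))
theorem2p3 Q k connected T∉𝒯₁ i _ =
  deletePart-strongConnected Q i connected T∉𝒯₁ , deletePart-isSemicompleteComposition Q i
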